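{- Let $k$ be an integer with $4 \le k \le 1000$ such that $4$ exactly divides $k$ (i.e. $4\mid k$ and $8\nmid k$) and $2k-1$ is a prime power. Then the only solution of the equation $x^2+(2k-1)^y=k^z$ in positive integers $x,y,z$ is $(x,y,z)=(k-1,1,2)$. -}

module Defs where

open import Data.Nat using (ℕ; _^_; _≤_)
open import Data.Nat.Primality using (Prime)
open import Data.Product using (∃₂; _×_)
open import Relation.Binary.PropositionalEquality using (_≡_)

IsPrimePower : ℕ → Set
IsPrimePower n = ∃₂ λ p m → Prime p × 1 ≤ m × n ≡ p ^ m

{-
Reducing modulo 4 shows that y is odd. If k ^ z = c ^ 2, then c - x and c + x are coprime
factors of the prime power q ^ y, where q = 2 k - 1; hence c - x = 1 and 2 c = q ^ y + 1,
which is an odd multiple of 2 k. So k ^ (z - 2) is an odd square, which forces z = 2.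
It remains to exclude odd z when k is not a square. For each such k this is a local
obstruction: for every pair of residues of the exponents y and z to a suitable smooth modulus
there is a prime n for which k ^ z - q ^ y is a quadratic non-residue.
-}
module Submission where

open import Defs
open import Data.Bool using (Bool; true; false; T; _∧_; _∨_)
open import Data.Bool.ListAction using (all; any)
open import Data.Bool.Properties using (T-∧; T-∨; T-≡)
open import Data.Empty using (⊥-elim)
open import Data.List using (List; []; _∷_; length)
open import Data.List.Relation.Unary.All using (lookupAny)
open import Data.List.Relation.Unary.All.Properties using (all⁺)
import Data.List.Relation.Unary.Any as Any
open import Data.List.Relation.Unary.Any.Properties using (any⁻)
open import Data.Nat
  using (ℕ; zero; suc; _+_; _*_; _∸_; _^_; _/_; _%_; _≤_; _<_; z≤n; s≤s; _<ᵇ_; _≡ᵇ_; _≟_; _<?_; NonZero; nonTrivial⇒n>1)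
open import Data.Nat.DivMod
open import Data.Nat.Divisibility
open import Data.Nat.Primality using (Prime; prime[2]; euclidsLemma; prime⇒nonZero; prime⇒nonTrivial)
open import Data.Nat.Properties hiding (_≟_; _<?_)
open import Data.Nat.Tactic.RingSolver using (solve-∀)
open import Data.Product using (∃; _×_; _,_; proj₁; proj₂)
open import Data.Sum using (_⊎_; inj₁; inj₂; [_,_]′)
open import Function using (_∘_; id)
open import Function.Bundles using (Equivalence)
open import Relation.Nullary using (¬_; yes; no; contradiction)
open import Relation.Nullary.Decidable using (from-no)
open import Relation.Binary.PropositionalEquality
  using (_≡_; refl; sym; trans; cong; cong₂; subst; subst₂; _≢_; module ≡-Reasoning)

-- Congruences cannot refute a class of exponents that contains a genuine solution, and (y, z) = (1,
-- 2) belongs to one for every k. The factorization settles every z for which k ^ z is a square, in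
-- particular every even z, so the congruences face only odd y and odd z, a class free of that
-- solution. Testing all pairs of residues to the final moduli at once would be costly. The moduli
-- of the exponents therefore grow by small factors, and only the pairs that no prime has excluded
-- so far are split further. A prime n becomes usable once the powers of q and k modulo n are
-- periodic with the current moduli of y and z.

-- Parity and sums of squares modulo 4

parity : ∀ n → ∃ λ h → n ≡ h * 2 ⊎ n ≡ suc (h * 2)
parity n with n % 2 | m%n<n n 2 | m≡m%n+[m/n]*n n 2
... | zero        | _              | eq = n / 2 , inj₁ eq
... | suc zero    | _              | eq = n / 2 , inj₂ eq
... | suc (suc _) | s≤s (s≤s ())   | _

odd-^ : ∀ a n → ∃ λ b → suc (a * 2) ^ n ≡ suc (b * 2)
odd-^ a zero    = 0 , refl
odd-^ a (suc n) with b , eq ← odd-^ a n = a + b + a * b * 2 , trans (cong (suc (a * 2) *_) eq) (expand a b)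
  where
  expand : ∀ a b → suc (a * 2) * suc (b * 2) ≡ suc ((a + b + a * b * 2) * 2)
  expand = solve-∀

4∤odd²+odd² : ∀ a b → ¬ 4 ∣ suc (a * 2) ^ 2 + suc (b * 2) ^ 2
4∤odd²+odd² a b 4∣ =
  from-no (4 ∣? 2)
    (∣m+n∣m⇒∣n (subst (4 ∣_) (expand a b) 4∣) (m∣m*n (a * a + a + b * b + b)))
  where
  expand : ∀ a b → suc (a * 2) * (suc (a * 2) * 1) + suc (b * 2) * (suc (b * 2) * 1) ≡ 4 * (a * a + a + b * b + b) + 2
  expand = solve-∀

4∤even²+odd² : ∀ a b → ¬ 4 ∣ (a * 2) ^ 2 + suc (b * 2) ^ 2
4∤even²+odd² a b 4∣ =
  from-no (4 ∣? 1)
    (∣m+n∣m⇒∣n (subst (4 ∣_) (expand a b) 4∣) (m∣m*n (a * a + b * b + b)))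
  where
  expand : ∀ a b → (a * 2) * ((a * 2) * 1) + suc (b * 2) * (suc (b * 2) * 1) ≡ 4 * (a * a + b * b + b) + 1
  expand = solve-∀

∣-^ : ∀ k z → 1 ≤ z → k ∣ k ^ z
∣-^ k (suc z) _ = m∣m*n (k ^ z)

-- Factorizations of a prime power

module _ {p : ℕ} (prime : Prime p) where

  instance
    p≢0 : NonZero p
    p≢0 = prime⇒nonZero prime

  1<p : 1 < p
  1<p = nonTrivial⇒n>1 p {{prime⇒nonTrivial prime}}

  prime∣^⇒prime∣ : ∀ k z → p ∣ k ^ z → p ∣ k
  prime∣^⇒prime∣ k zero    p∣ = contradiction p∣ (>⇒∤ 1<p)
  prime∣^⇒prime∣ k (suc z) p∣ = [ id , prime∣^⇒prime∣ k z ]′ (euclidsLemma k (k ^ z) prime p∣)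

  -- Euclid's lemma puts a factor p into the cofactor `e`, since p does not divide `d`; cancelling
  -- it there lowers the exponent by one.
  ∣p^n∧p∤⇒≡1 : ∀ n {d} → d ∣ p ^ n → ¬ p ∣ d → d ≡ 1
  ∣p^n∧p∤⇒≡1 zero        d∣             _   = ∣1⇒≡1 d∣
  ∣p^n∧p∤⇒≡1 (suc n) {d} (divides e eq) p∤d
    with euclidsLemma e d prime (divides (p ^ n) (trans (sym eq) (*-comm p (p ^ n))))
  ... | inj₂ p∣d              = contradiction p∣d p∤d
  ... | inj₁ (divides f refl) =
    ∣p^n∧p∤⇒≡1 n (divides f (*-cancelˡ-≡ (p ^ n) (f * d) p (trans eq (regroup f p d)))) p∤d
    where
    regroup : ∀ f p d → f * p * d ≡ p * (f * d)
    regroup = solve-∀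

  -- p ^ n = (c - x) * (c + x) with coprime factors, since p does not divide their sum.
  x²+p^n≡c²⇒consecutive : ∀ {n x c} → 1 ≤ x → ¬ p ∣ 2 * c → x ^ 2 + p ^ n ≡ c * c → c ≡ suc x × suc (p ^ n) ≡ 2 * c
  x²+p^n≡c²⇒consecutive {n} {x} {c} 1≤x p∤2c eq with x <? c
  ... | no  x≮c = contradiction (<-≤-trans (m<m+n (x ^ 2) (m^n>0 p n)) (≤-reflexive eq))
                    (≤⇒≯ (≤-trans (*-mono-≤ (≮⇒≥ x≮c) (≮⇒≥ x≮c))
                      (≤-reflexive (cong (x *_) (sym (*-identityʳ x))))))
  ... | yes x<c with m≤n⇒∃[o]m+o≡n (<⇒≤ x<c)
  ... | d , refl = finish d≡1
    where
    square : ∀ x d → (x + d) * (x + d) ≡ x * (x * 1) + d * (x + (x + d))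
    square = solve-∀
    sum : ∀ x d → 2 * (x + d) ≡ d + (x + (x + d))
    sum = solve-∀
    factors : p ^ n ≡ d * (x + (x + d))
    factors = +-cancelˡ-≡ (x ^ 2) _ _ (trans eq (square x d))
    d≡1 : d ≡ 1
    d≡1 with p ∣? d
    ... | no  p∤d = ∣p^n∧p∤⇒≡1 n (divides (x + (x + d)) (trans factors (*-comm d _))) p∤d
    -- `d` is c - x and `x + (x + d)` is c + x. Their sum is 2 c, so p cannot divide both. If p
    -- divides `d`, then the other factor must be 1, but it is at least 2 because x is positive.
    ... | yes p∣d = contradiction e≡1 (>⇒≢ (≤-trans (+-mono-≤ 1≤x 1≤x) (+-monoʳ-≤ x (m≤m+n x d))))
      where
      e≡1 : x + (x + d) ≡ 1
      e≡1 = ∣p^n∧p∤⇒≡1 n (divides d factors) (λ p∣e → p∤2c (subst (p ∣_) (sym (sum x d)) (∣m∣n⇒∣m+n p∣d p∣e)))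
    double : ∀ x → suc (1 * (x + (x + 1))) ≡ 2 * (x + 1)
    double = solve-∀
    finish : d ≡ 1 → x + d ≡ suc x × suc (p ^ n) ≡ 2 * (x + d)
    finish refl = +-comm x 1 , trans (cong suc factors) (double x)

-- Exponents when k ^ z is a square

-- The square of q = 2 k - 1 is 1 + 4 k (k - 1).
[2k-1]^even : ∀ k s → ∃ λ t → suc (k * 2) ^ (s * 2) ≡ 1 + t * (4 * suc k)
[2k-1]^even k zero    = 0 , refl
[2k-1]^even k (suc s) with t , eq ← [2k-1]^even k s =
  t + k + k * t * (4 * suc k) , trans (cong (λ r → suc (k * 2) * (suc (k * 2) * r)) eq) (expand k t)
  where
  expand : ∀ k t → suc (k * 2) * (suc (k * 2) * (1 + t * (4 * suc k))) ≡ 1 + (t + k + k * t * (4 * suc k)) * (4 * suc k)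
  expand = solve-∀

even∤odd : ∀ h → ¬ 2 ∣ suc (h * 2)
even∤odd h 2∣ = from-no (2 ∣? 1)
  (∣m+n∣m⇒∣n (subst (2 ∣_) (+-comm 1 (h * 2)) 2∣) (n∣m*n h))

-- 2 c = q ^ y + 1 is 2 k times the odd number 1 + 2 t q, and k is even.
square-power : ∀ k → 4 ≤ suc k → 2 ∣ suc k → ∀ s z c → c * c ≡ suc k ^ z →
               suc (suc (k * 2) ^ suc (s * 2)) ≡ 2 * c → c ≡ suc k × s ≡ 0 × z ≡ 2
square-power k 4≤k 2∣k s z c c²≡k^z 2c with t , q^2s ← [2k-1]^even k s =
  exponents z (trans (sym c²≡k^z) (trans (cong₂ _*_ c≡ko c≡ko) (regroup K (o t))))
  where
  K = suc k
  q = suc (k * 2)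
  o : ℕ → ℕ
  o t = suc (t * q * 2)
  expand : ∀ k t → suc (suc (k * 2) * (1 + t * (4 * suc k))) ≡ 2 * (suc k * suc (t * suc (k * 2) * 2))
  expand = solve-∀
  c≡ko : c ≡ K * o t
  c≡ko = *-cancelˡ-≡ c (K * o t) 2 (trans (sym 2c) (trans (cong (λ r → suc (q * r)) q^2s) (expand k t)))
  regroup : ∀ K o → K * o * (K * o) ≡ K * (K * (o * o))
  regroup = solve-∀
  K≢1 : K ≢ 1
  K≢1 refl = contradiction 4≤k (λ { (s≤s ()) })
  -- Since 2 K = q + 1, the equation says q ^ y = q with y = 2 s + 1, and powers of q > 1 increase
  -- strictly.
  s≡0 : ∀ s → suc (q ^ suc (s * 2)) ≡ 2 * K → s ≡ 0
  s≡0 zero    _  = refl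
  s≡0 (suc s) eq = contradiction
    (suc-injective (trans eq (trans (*-comm 2 K) (cong (λ r → suc (suc r)) (sym (*-identityʳ (k * 2)))))))
    (>⇒≢ (^-monoʳ-< q 1<q {1} {suc (suc s * 2)} (s≤s (s≤s z≤n))))
    where
    1<q : 1 < q
    1<q = s≤s (≤-trans (≤-pred (≤-trans (s≤s (s≤s z≤n)) 4≤k)) (m≤m*n k 2))
  -- For z < 2 the factor K would divide 1. Otherwise two factors K cancel and leave K ^ (z - 2)
  -- equal to an odd square, whereas positive powers of the even K are even.
  exponents : ∀ z → K ^ z ≡ K * (K * (o t * o t)) → c ≡ K × s ≡ 0 × z ≡ 2
  exponents zero          eq = contradiction (m*n≡1⇒m≡1 K _ (sym eq)) K≢1
  exponents (suc zero)    eq = contradiction (m*n≡1⇒m≡1 K _ (sym (*-cancelˡ-≡ 1 _ K eq))) K≢1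
  exponents (suc (suc n)) eq with *-cancelˡ-≡ _ _ K (*-cancelˡ-≡ _ _ K eq)
  exponents (suc (suc (suc n))) eq | k^n≡o² =
    ⊥-elim ([ even∤odd (t * q) , even∤odd (t * q) ]′
      (euclidsLemma (o t) (o t) prime[2] (subst (2 ∣_) k^n≡o² (∣-trans 2∣k (m∣m*n (K ^ n))))))
  exponents (suc (suc zero))    eq | 1≡o²   = c≡k , s≡0 s (trans 2c (cong (2 *_) c≡k)) , refl
    where
    c≡k : c ≡ K
    c≡k = trans c≡ko (trans (cong (K *_) (m*n≡1⇒m≡1 (o t) (o t) (sym 1≡o²))) (*-identityʳ K))

-- Computing with powers modulo n, and Euler's criterion

-- Unlike all p (upTo n), this passes literals to p, so that it evaluates fast.
allBelow : (ℕ → Bool) → ℕ → Bool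
allBelow p zero    = true
allBelow p (suc n) = p n ∧ allBelow p n

allBelow-sound : ∀ p n → T (allBelow p n) → ∀ {x} → x < n → T (p x)
allBelow-sound p (suc n) ok {x} x<1+n with x ≟ n
... | yes refl = proj₁ (Equivalence.to T-∧ ok)
... | no  x≢n  = allBelow-sound p n (proj₂ (Equivalence.to T-∧ ok)) (≤∧≢⇒< (m<1+n⇒m≤n x<1+n) x≢n)

module _ {n : ℕ} .{{_ : NonZero n}} where

  +-cong-% : ∀ a b c d → a % n ≡ b % n → c % n ≡ d % n → (a + c) % n ≡ (b + d) % n
  +-cong-% a b c d p r =
    trans (%-distribˡ-+ a c n) (trans (cong₂ (λ u v → (u + v) % n) p r) (sym (%-distribˡ-+ b d n)))

  *-cong-% : ∀ a b c d → a % n ≡ b % n → c % n ≡ d % n → (a * c) % n ≡ (b * d) % n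
  *-cong-% a b c d p r =
    trans (%-distribˡ-* a c n) (trans (cong₂ (λ u v → (u * v) % n) p r) (sym (%-distribˡ-* b d n)))

  ^-cong-% : ∀ e a b → a % n ≡ b % n → (a ^ e) % n ≡ (b ^ e) % n
  ^-cong-% zero    a b p = refl
  ^-cong-% (suc e) a b p = *-cong-% a b (a ^ e) (b ^ e) p (^-cong-% e a b p)

  -- The factor c in front allows n and c to have a common divisor.
  ^-periodic-% : ∀ c e → (c * c ^ e) % n ≡ c % n → ∀ a i → (c ^ suc (a + i * e)) % n ≡ (c ^ suc a) % n
  ^-periodic-% c e p a zero    = cong (λ s → (c ^ suc s) % n) (+-identityʳ a)
  ^-periodic-% c e p a (suc i) = begin
    (c ^ suc (a + (e + i * e))) % n       ≡⟨ cong (λ s → (c ^ s) % n) (exponent a e i) ⟩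
    (c ^ (suc e + (a + i * e))) % n       ≡⟨ cong (_% n) (^-distribˡ-+-* c (suc e) (a + i * e)) ⟩
    (c ^ suc e * c ^ (a + i * e)) % n     ≡⟨ *-cong-% (c ^ suc e) c (c ^ (a + i * e)) _ p refl ⟩
    (c ^ suc (a + i * e)) % n             ≡⟨ ^-periodic-% c e p a i ⟩
    (c ^ suc a) % n                       ∎
    where
    open ≡-Reasoning
    exponent : ∀ a e i → suc (a + (e + i * e)) ≡ suc e + (a + i * e)
    exponent = solve-∀

module _ (m : ℕ) where

  multiplyIf : ℕ → ℕ → ℕ → ℕ
  multiplyIf zero    c r = r
  multiplyIf (suc _) c r = r * c % suc m

  -- Binary exponentiation, so that large exponents can be evaluated. The exponent at least halves
  -- in each call, hence it is itself enough fuel for the structural recursion.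
  squareMultiply : (fuel c e : ℕ) → ℕ
  squareMultiply zero    c e       = 1
  squareMultiply (suc f) c zero    = 1
  squareMultiply (suc f) c (suc e) =
    multiplyIf (suc e % 2) c (squareMultiply f (c * c % suc m) (suc e / 2))

  powMod : ℕ → ℕ → ℕ
  powMod c e = squareMultiply e c e % suc m

  multiplyIf-correct : ∀ i c r → i < 2 → multiplyIf i c r % suc m ≡ (c ^ i * r) % suc m
  multiplyIf-correct zero          c r _             = cong (_% suc m) (sym (+-identityʳ r))
  multiplyIf-correct (suc zero)    c r _             =
    trans (m%n%n≡m%n (r * c) (suc m)) (cong (_% suc m) (trans (*-comm r c) (cong (_* r) (sym (*-identityʳ c)))))
  multiplyIf-correct (suc (suc i)) c r (s≤s (s≤s ()))

  squareMultiply-correct : ∀ f c e → e ≤ f → squareMultiply f c e % suc m ≡ (c ^ e) % suc m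
  squareMultiply-correct zero    c zero    z≤n       = refl
  squareMultiply-correct (suc f) c zero    _         = refl
  squareMultiply-correct (suc f) c (suc e) (s≤s e≤f) = begin
    multiplyIf i c r % suc m     ≡⟨ multiplyIf-correct i c r (m%n<n (suc e) 2) ⟩
    (c ^ i * r) % suc m          ≡⟨ *-cong-% (c ^ i) (c ^ i) r (c² ^ h) refl r-correct ⟩
    (c ^ i * c² ^ h) % suc m     ≡⟨ *-cong-% (c ^ i) (c ^ i) (c² ^ h) ((c * c) ^ h) refl
                                      (^-cong-% h c² (c * c) (m%n%n≡m%n (c * c) (suc m))) ⟩
    (c ^ i * (c * c) ^ h) % suc m
      ≡⟨ cong (λ s → (c ^ i * (c * s) ^ h) % suc m) (sym (*-identityʳ c)) ⟩
    (c ^ i * (c ^ 2) ^ h) % suc m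
      ≡⟨ cong (λ s → (c ^ i * s) % suc m) (^-*-assoc c 2 h) ⟩
    (c ^ i * c ^ (2 * h)) % suc m
      ≡⟨ cong (_% suc m) (sym (^-distribˡ-+-* c i (2 * h))) ⟩
    (c ^ (i + 2 * h)) % suc m
      ≡⟨ cong (λ s → (c ^ s) % suc m)
           (trans (cong (i +_) (*-comm 2 h)) (sym (m≡m%n+[m/n]*n (suc e) 2))) ⟩
    (c ^ suc e) % suc m          ∎
    where
    open ≡-Reasoning
    i h c² r : ℕ
    i = suc e % 2
    h = suc e / 2
    c² = c * c % suc m
    r = squareMultiply f c² h
    r-correct : r % suc m ≡ (c² ^ h) % suc m
    r-correct = squareMultiply-correct f c² h
      (≤-trans (m<1+n⇒m≤n (m/n<m (suc e) 2 (s≤s (s≤s z≤n)))) e≤f)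

  powMod-correct : ∀ c e → powMod c e ≡ (c ^ e) % suc m
  powMod-correct c e = squareMultiply-correct e c e ≤-refl

  -- For an odd prime `suc m` the tested power is x ^ m, which by Fermat's little theorem is 1, or 0
  -- if the prime divides x; hence the bound 2. A quadratic non-residue would give `m` itself, which
  -- is at least 2.
  eulerCriterion : Bool
  eulerCriterion = allBelow (λ x → powMod (x * x) (m / 2) <ᵇ 2) (suc m)

  eulerCriterion-sound : T eulerCriterion → ∀ x → ((x ^ 2) ^ (m / 2)) % suc m < 2
  eulerCriterion-sound ok x = subst (_< 2) eq
    (<ᵇ⇒< _ 2 (allBelow-sound _ (suc m) ok (m%n<n x (suc m))))
    where
    y : ℕ
    y = x % suc m
    eq : powMod (y * y) (m / 2) ≡ ((x ^ 2) ^ (m / 2)) % suc m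
    eq = trans (powMod-correct (y * y) (m / 2))
      (^-cong-% (m / 2) (y * y) (x ^ 2) (trans (cong (λ s → (y * s) % suc m) (sym (*-identityʳ y)))
        (^-cong-% 2 y x (m%n%n≡m%n x (suc m)))))

-- Euler's criterion is needed only for these primes, where checking it on all residues
-- replaces a proof for general primes.
moduli : List ℕ
moduli =
  3 ∷ 5 ∷ 7 ∷ 11 ∷ 13 ∷ 17 ∷ 19 ∷ 23 ∷ 29 ∷ 31 ∷ 37 ∷ 41 ∷ 43 ∷ 61 ∷ 67 ∷ 71 ∷ 73 ∷ 89 ∷ 97 ∷
  101 ∷ 109 ∷ 113 ∷ 127 ∷ 151 ∷ 163 ∷ 181 ∷ 193 ∷ 199 ∷ 211 ∷ 241 ∷ 257 ∷ 271 ∷ 281 ∷ 331 ∷ 337 ∷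
  353 ∷ 379 ∷ 397 ∷ 401 ∷ 421 ∷ 433 ∷ 449 ∷ 487 ∷ 541 ∷ 577 ∷ 601 ∷ 631 ∷ 641 ∷ 661 ∷ 673 ∷ 701 ∷
  751 ∷ 757 ∷ 761 ∷ 769 ∷ 811 ∷ 881 ∷ 991 ∷ 1009 ∷ 1153 ∷ 1171 ∷ 1201 ∷ 1297 ∷ 1321 ∷ 1601 ∷
  1621 ∷ 1801 ∷ 1873 ∷ 2017 ∷ 2089 ∷ 2161 ∷ 2179 ∷ 2269 ∷ 2377 ∷ 2521 ∷ 2593 ∷ 2647 ∷ 2689 ∷
  2917 ∷ 3169 ∷ 3301 ∷ 3331 ∷ 3361 ∷ 3457 ∷ 3889 ∷ 4051 ∷ 4201 ∷ 4441 ∷ 4561 ∷ 4801 ∷ 4861 ∷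
  4951 ∷ 5281 ∷ 6301 ∷ 6481 ∷ 7561 ∷ 8101 ∷ 8641 ∷ 8929 ∷ 9001 ∷ 9601 ∷ 9721 ∷ 14401 ∷ 15121 ∷
  19009 ∷ 20161 ∷ 21601 ∷ 23761 ∷ []

eulerModulus : ℕ → Bool
eulerModulus zero    = false
eulerModulus (suc m) = eulerCriterion m

moduli-euler : all eulerModulus moduli ≡ true
moduli-euler = refl

-- Lets the costly check of Euler's criterion be made once per prime of the list: each later use of
-- a prime needs only a Boolean search for it.
all∧any⇒ : ∀ p xs n → all p xs ≡ true → T (any (n ≡ᵇ_) xs) → T (p n)
all∧any⇒ p xs n all≡true n∈xs = subst (T ∘ p) (sym (≡ᵇ⇒≡ n _ (proj₂ found))) (proj₁ found)
  where
  found = lookupAny (all⁺ p xs (Equivalence.from T-≡ all≡true)) (any⁻ (n ≡ᵇ_) xs n∈xs)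

-- The sieve on pairs of exponents

-- refine r s ns splits each class of exponents modulo (M , N) into the r * s classes
-- modulo (r * M , s * N) that it contains, and tests them with the moduli ns. The residues
-- (a , b) are those of (y - 1 , z - 1), so that only positive exponents occur.
data Refinement : Set where
  refine : (r s : ℕ) → List ℕ → Refinement

module _ (k q : ℕ) where

  Solution : ℕ → ℕ → ℕ → Set
  Solution x y z = x ^ 2 + q ^ y ≡ k ^ z

  -- The two congruences are the hypothesis of `^-periodic-%` for q and k: modulo n the powers q ^ y
  -- and k ^ z with positive exponents then depend only on y modulo `M` and z modulo `N`.
  admissible : (M N n : ℕ) → Bool
  admissible M N zero    = false
  admissible M N (suc m) =
    (powMod m q (suc M) ≡ᵇ q % suc m) ∧ (powMod m k (suc N) ≡ᵇ k % suc m) ∧ any (suc m ≡ᵇ_) moduli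

  -- Since n - 1 ≡ -1, the base is congruent to k ^ suc b - q ^ suc a, which is x ^ 2 for a solution.
  detects : (a b n : ℕ) → Bool
  detects a b zero    = false
  detects a b (suc m) = 1 <ᵇ powMod m (powMod m k (suc b) + m * powMod m q (suc a)) (m / 2)

  -- For a solution the tested base would be congruent to x ^ 2, and Euler's criterion bounds the
  -- power of a square by 1.
  detects-sound : ∀ {M N} a b n → T (admissible M N n) → T (detects a b n) →
                  ∀ i j x → ¬ Solution x (suc (a + i * M)) (suc (b + j * N))
  detects-sound {M} {N} a b (suc m) adm det i j x sol =
    <⇒≱ (subst (1 <_) power≡ (<ᵇ⇒< 1 _ det)) (m<1+n⇒m≤n (eulerCriterion-sound m euler x))
    where
    open ≡-Reasoning
    n Q u : ℕ
    n = suc m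
    adm₁ = Equivalence.to T-∧ adm
    adm₂ = Equivalence.to T-∧ (proj₂ adm₁)
    q-period : ∀ a i → (q ^ suc (a + i * M)) % n ≡ (q ^ suc a) % n
    q-period = ^-periodic-% q M (trans (sym (powMod-correct m q (suc M))) (≡ᵇ⇒≡ _ _ (proj₁ adm₁)))
    k-period : ∀ b j → (k ^ suc (b + j * N)) % n ≡ (k ^ suc b) % n
    k-period = ^-periodic-% k N (trans (sym (powMod-correct m k (suc N))) (≡ᵇ⇒≡ _ _ (proj₁ adm₂)))
    euler : T (eulerModulus n)
    euler = all∧any⇒ eulerModulus moduli n moduli-euler (proj₂ adm₂)
    reduce : ∀ c e → powMod m c e % n ≡ (c ^ e) % n
    reduce c e = trans (cong (_% n) (powMod-correct m c e)) (m%n%n≡m%n (c ^ e) n)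
    Q = q ^ suc (a + i * M)
    u = powMod m k (suc b) + m * powMod m q (suc a)
    regroup : ∀ X Q m → X + Q + m * Q ≡ X + Q * suc m
    regroup = solve-∀
    u≡x² : u % n ≡ (x ^ 2) % n
    u≡x² = begin
      u % n
        ≡⟨ +-cong-% (powMod m k (suc b)) (k ^ suc (b + j * N)) (m * powMod m q (suc a)) (m * Q)
             (trans (reduce k (suc b)) (sym (k-period b j)))
             (*-cong-% m m (powMod m q (suc a)) Q refl (trans (reduce q (suc a)) (sym (q-period a i)))) ⟩
      (k ^ suc (b + j * N) + m * Q) % n  ≡⟨ cong (λ s → (s + m * Q) % n) (sym sol) ⟩
      (x ^ 2 + Q + m * Q) % n            ≡⟨ cong (_% n) (regroup (x ^ 2) Q m) ⟩
      (x ^ 2 + Q * n) % n                ≡⟨ [m+kn]%n≡m%n (x ^ 2) Q n ⟩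
      (x ^ 2) % n                        ∎
    power≡ : powMod m u (m / 2) ≡ ((x ^ 2) ^ (m / 2)) % n
    power≡ = trans (powMod-correct m u (m / 2)) (^-cong-% (m / 2) u (x ^ 2) u≡x²)

  -- Admissibility depends on the moduli alone and not on the residues, so it is tested apart from
  -- `sieve`, once per modulus instead of once per class.
  allAdmissible : List Refinement → (M N : ℕ) → Bool
  allAdmissible []                   M N = true
  allAdmissible (refine r s ns ∷ rs) M N =
    all (admissible (r * M) (s * N)) ns ∧ allAdmissible rs (r * M) (s * N)

  -- The search in `ns` stops at the first prime that excludes the subclass; only surviving
  -- subclasses descend to `rs`.
  sieve : List Refinement → (M N a b : ℕ) → Bool
  sieve (refine (suc r) (suc s) ns ∷ rs) M N a b =
    allBelow (λ i → allBelow (λ j →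
      any (detects (a + i * M) (b + j * N)) ns ∨
      sieve rs (suc r * M) (suc s * N) (a + i * M) (b + j * N))
      (suc s)) (suc r)
  -- A class that outlives all refinements makes the certificate fail.
  sieve _ M N a b = false

  sieve-sound : ∀ rs M N a b → T (allAdmissible rs M N) → T (sieve rs M N a b) →
                ∀ i j x → ¬ Solution x (suc (a + i * M)) (suc (b + j * N))
  sieve-sound (refine (suc r) (suc s) ns ∷ rs) M N a b adm ok i j x =
    -- The remainders of `i` and `j` select the subclass that contains the exponents, and the
    -- quotients are their positions in it.
    subst₂ (λ y z → ¬ Solution x (suc y) (suc z)) (split a i r M) (split b j s N)
      ([ (λ detected → let adm-n , det = lookupAny (all⁺ _ ns (proj₁ adm′)) (any⁻ _ ns detected)
                       in detects-sound (a + i % suc r * M) (b + j % suc s * N)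
                            (Any.lookup (any⁻ _ ns detected)) adm-n det (i / suc r) (j / suc s) x)
       , (λ sieved → sieve-sound rs (suc r * M) (suc s * N) _ _ (proj₂ adm′) sieved (i / suc r) (j / suc s) x)
       ]′ (Equivalence.to T-∨ excluded))
    where
    adm′ = Equivalence.to T-∧ adm
    excluded = allBelow-sound _ (suc s) (allBelow-sound _ (suc r) ok (m%n<n i (suc r))) (m%n<n j (suc s))
    regroup : ∀ a c d r M → a + c * M + d * (r * M) ≡ a + (c + d * r) * M
    regroup = solve-∀
    split : ∀ a i r M → a + i % suc r * M + i / suc r * (suc r * M) ≡ a + i * M
    split a i r M = trans (regroup a (i % suc r) (i / suc r) (suc r) M)
      (cong (λ t → a + t * M) (sym (m≡m%n+[m/n]*n i (suc r))))

-- From a square root of k ^ z to the solution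

^-square : ∀ c n → c ^ n * c ^ n ≡ c ^ (n * 2)
^-square c n = trans (cong (c ^ n *_) (sym (*-identityʳ (c ^ n)))) (^-*-assoc c n 2)

module _ (k : ℕ) where

  private
    K = suc k
    q = suc (k * 2)

  -- For even y the power q ^ y is an odd square, so the left side is 1 or 2 modulo 4, while 4
  -- divides K ^ z because z is positive.
  exponent-odd : ∀ x y z → 4 ∣ K → 1 ≤ z → Solution K q x y z → ∃ λ s → y ≡ suc (s * 2)
  exponent-odd x y z 4∣K 1≤z sol with parity y
  ... | s , inj₂ y≡   = s , y≡
  ... | s , inj₁ refl = contradiction (∣-trans 4∣K (∣-^ K z 1≤z)) (subst (λ n → ¬ 4 ∣ n) sum≡ 4∤sum)
    where
    b : ℕ
    b = proj₁ (odd-^ k s)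
    sum≡ : x ^ 2 + suc (b * 2) ^ 2 ≡ K ^ z
    sum≡ = trans (cong (x ^ 2 +_) (trans (cong (_^ 2) (sym (proj₂ (odd-^ k s)))) (^-*-assoc q s 2))) sol
    4∤sum : ¬ 4 ∣ x ^ 2 + suc (b * 2) ^ 2
    4∤sum with parity x
    ... | a , inj₁ refl = 4∤even²+odd² a b
    ... | a , inj₂ refl = 4∤odd²+odd² a b

  -- Any square root `c` of K ^ z will do, so the same argument serves even z and, when K is a
  -- square, odd z.
  solution-with-square : IsPrimePower q → 4 ≤ K → 2 ∣ K → ∀ x s z c → 1 ≤ x → c * c ≡ K ^ z →
                         Solution K q x (suc (s * 2)) z → x ≡ k × s ≡ 0 × z ≡ 2
  solution-with-square (p , m , p-prime , 1≤m , q≡p^m) 4≤K 2∣K x s z c 1≤x c²≡K^z sol =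
    suc-injective (trans (sym (proj₁ consecutive)) (proj₁ exponents)) , proj₂ exponents
    where
    y : ℕ
    y = suc (s * 2)
    q^y : q ^ y ≡ p ^ (m * y)
    q^y = trans (cong (_^ y) q≡p^m) (^-*-assoc p m y)
    p∣q : p ∣ q
    p∣q = subst (p ∣_) (sym q≡p^m) (∣-^ p m 1≤m)
    -- q + 1 = 2 K, so a common divisor of q and 2 K divides 1. This also keeps p away from 2 and
    -- from K, hence from `c`.
    p∤2K : ¬ p ∣ K * 2
    p∤2K p∣2K = >⇒∤ (1<p p-prime) (∣m+n∣m⇒∣n (subst (p ∣_) (+-comm 1 q) p∣2K) p∣q)
    p∤c : ¬ p ∣ c
    p∤c p∣c = p∤2K (∣-trans (prime∣^⇒prime∣ p-prime K z (subst (p ∣_) c²≡K^z (∣-trans p∣c (m∣m*n c)))) (m∣m*n 2))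
    p∤2c : ¬ p ∣ 2 * c
    p∤2c p∣2c = [ (λ p∣2 → p∤2K (∣-trans p∣2 (n∣m*n K))) , p∤c ]′ (euclidsLemma 2 c p-prime p∣2c)
    consecutive : c ≡ suc x × suc (p ^ (m * y)) ≡ 2 * c
    consecutive = x²+p^n≡c²⇒consecutive p-prime {m * y} 1≤x p∤2c
      (trans (cong (x ^ 2 +_) (sym q^y)) (trans sol (sym c²≡K^z)))
    exponents : c ≡ K × s ≡ 0 × z ≡ 2
    exponents = square-power k 4≤K 2∣K s z c c²≡K^z (trans (cong suc q^y) (proj₂ consecutive))

-- Certificates for the individual k

data Certificate : Set where
  square : ℕ → Certificate
  sieved : List Refinement → Certificate

valid : ℕ → Certificate → Bool
valid k (square t)  = t * t ≡ᵇ k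
-- The start is the class of y - 1 and z - 1 both even, that is, y and z both odd.
valid k (sieved rs) = allAdmissible k (2 * k ∸ 1) rs 2 2 ∧ sieve k (2 * k ∸ 1) rs 2 2 0 0

-- The certificates belong to k, k + 8, k + 16, …
allValid : ℕ → List Certificate → Bool
allValid k []       = true
allValid k (c ∷ cs) = valid k c ∧ allValid (8 + k) cs

allValid-sound : ∀ k cs → allValid k cs ≡ true → ∀ h → h < length cs → ∃ λ c → T (valid (h * 8 + k) c)
allValid-sound k (c ∷ cs) ok zero    _        =
  c , proj₁ (Equivalence.to (T-∧ {valid k c}) (Equivalence.from T-≡ ok))
allValid-sound k (c ∷ cs) ok (suc h) (s≤s h<)
  with c′ , ok′ ← allValid-sound (8 + k) cs
    (Equivalence.to T-≡ (proj₂ (Equivalence.to (T-∧ {valid k c}) (Equivalence.from T-≡ ok)))) h h<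
  = c′ , subst (λ n → T (valid n c′)) (shift h k) ok′
  where
  shift : ∀ h k → h * 8 + (8 + k) ≡ 8 + h * 8 + k
  shift = solve-∀

-- Found by a best-first search for few tests in total.
certificates : List Certificate
certificates =
  square 2 ∷
  sieved (refine 3 1 (13 ∷ []) ∷ refine 1 3 (7 ∷ []) ∷ refine 2 3 (37 ∷ []) ∷ refine 3 3 (109 ∷ 271 ∷ []) ∷
    refine 1 2 (73 ∷ []) ∷ refine 10 1 (1801 ∷ []) ∷ refine 1 5 (31 ∷ 61 ∷ 181 ∷ []) ∷
    refine 3 1 (541 ∷ []) ∷ refine 1 3 (163 ∷ 1621 ∷ []) ∷ []) ∷
  -- Here k is 2 modulo 3, so 3 divides 2 k - 1 and x ^ 2 would be congruent to 2 ^ z, a non-residue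
  -- for every odd z. The same holds for each later entry with the single prime 3.
  sieved (refine 1 1 (3 ∷ []) ∷ []) ∷
  sieved (refine 1 2 (5 ∷ []) ∷ []) ∷
  square 6 ∷
  sieved (refine 1 1 (3 ∷ []) ∷ []) ∷
  sieved (refine 5 5 (11 ∷ []) ∷ refine 3 1 (61 ∷ []) ∷ refine 1 3 (7 ∷ 31 ∷ []) ∷ refine 1 3 (19 ∷ []) ∷
    refine 3 1 (127 ∷ []) ∷ refine 2 1 (181 ∷ []) ∷ refine 1 2 (37 ∷ []) ∷ refine 1 2 (41 ∷ []) ∷
    refine 2 1 (73 ∷ []) ∷ refine 2 1 (2161 ∷ []) ∷ refine 1 2 (241 ∷ []) ∷ refine 1 2 (97 ∷ 641 ∷ []) ∷
    refine 1 3 (433 ∷ []) ∷ refine 3 1 (109 ∷ 271 ∷ 541 ∷ 2593 ∷ 8641 ∷ []) ∷ refine 1 3 (3889 ∷ []) ∷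
    refine 3 1 (163 ∷ 811 ∷ 1297 ∷ 1621 ∷ 4861 ∷ 6481 ∷ []) ∷ refine 4 2 (193 ∷ 577 ∷ 3457 ∷ []) ∷ []) ∷
  sieved (refine 5 1 (61 ∷ []) ∷ []) ∷
  sieved (refine 1 1 (3 ∷ []) ∷ []) ∷
  sieved (refine 3 1 (7 ∷ []) ∷ refine 5 1 (11 ∷ []) ∷ refine 1 15 (31 ∷ []) ∷ refine 2 1 (61 ∷ []) ∷
    refine 1 2 (13 ∷ []) ∷ refine 1 2 (601 ∷ []) ∷ refine 2 1 (17 ∷ 41 ∷ []) ∷
    refine 1 2 (241 ∷ 401 ∷ []) ∷ refine 3 1 (73 ∷ []) ∷ refine 1 3 (37 ∷ []) ∷ refine 2 1 (577 ∷ []) ∷ []) ∷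
  sieved (refine 2 1 (5 ∷ []) ∷ refine 4 1 (17 ∷ []) ∷ refine 1 10 (41 ∷ []) ∷ refine 5 1 (11 ∷ []) ∷
    refine 3 1 (61 ∷ []) ∷ refine 3 1 (271 ∷ []) ∷ refine 1 3 (13 ∷ 19 ∷ 31 ∷ 37 ∷ []) ∷
    refine 1 5 (151 ∷ []) ∷ refine 1 2 (601 ∷ 1201 ∷ []) ∷ refine 1 3 (73 ∷ 181 ∷ []) ∷
    refine 1 2 (241 ∷ 433 ∷ []) ∷ refine 3 1 (2161 ∷ []) ∷ refine 1 3 (109 ∷ 541 ∷ []) ∷
    refine 1 2 (97 ∷ []) ∷ refine 1 2 (577 ∷ 8641 ∷ []) ∷ []) ∷
  sieved (refine 1 1 (3 ∷ []) ∷ []) ∷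
  square 10 ∷
  sieved (refine 1 2 (5 ∷ []) ∷ []) ∷
  sieved (refine 1 1 (3 ∷ []) ∷ []) ∷
  sieved (refine 1 6 (13 ∷ []) ∷ []) ∷
  sieved (refine 3 1 (7 ∷ []) ∷ refine 3 1 (19 ∷ []) ∷ refine 1 6 (13 ∷ []) ∷ refine 5 1 (181 ∷ []) ∷
    refine 4 1 (17 ∷ 41 ∷ []) ∷ refine 1 3 (37 ∷ 109 ∷ []) ∷ refine 1 2 (73 ∷ []) ∷
    refine 1 5 (31 ∷ 61 ∷ 271 ∷ []) ∷ refine 5 1 (151 ∷ 601 ∷ []) ∷ refine 1 5 (101 ∷ 1801 ∷ 9601 ∷ []) ∷
    refine 2 1 (2161 ∷ []) ∷ refine 1 2 (241 ∷ 401 ∷ []) ∷ refine 2 1 (97 ∷ []) ∷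
    refine 1 2 (577 ∷ 1601 ∷ 8929 ∷ []) ∷ refine 2 2 (193 ∷ []) ∷ []) ∷
  sieved (refine 1 1 (3 ∷ []) ∷ []) ∷
  sieved (refine 1 2 (5 ∷ []) ∷ []) ∷
  sieved (refine 3 3 (7 ∷ []) ∷ refine 5 5 (11 ∷ 211 ∷ []) ∷ refine 2 1 (61 ∷ 181 ∷ []) ∷ refine 3 2 (37 ∷ []) ∷
    refine 1 2 (73 ∷ []) ∷ refine 1 3 (19 ∷ []) ∷ refine 1 3 (109 ∷ []) ∷ refine 3 1 (271 ∷ 541 ∷ []) ∷
    refine 2 1 (41 ∷ []) ∷ refine 2 1 (433 ∷ 2161 ∷ []) ∷ refine 1 2 (17 ∷ 241 ∷ 15121 ∷ []) ∷
    refine 2 2 (97 ∷ 3457 ∷ []) ∷ []) ∷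
  sieved (refine 1 1 (3 ∷ []) ∷ []) ∷
  sieved (refine 2 3 (13 ∷ []) ∷ refine 9 1 (109 ∷ []) ∷ refine 1 4 (2377 ∷ []) ∷ refine 2 2 (193 ∷ []) ∷
    refine 2 1 (17 ∷ 433 ∷ []) ∷ refine 1 3 (37 ∷ 73 ∷ []) ∷ refine 1 5 (181 ∷ []) ∷
    refine 5 1 (11 ∷ 31 ∷ 41 ∷ 241 ∷ 541 ∷ []) ∷ refine 1 3 (271 ∷ 2161 ∷ []) ∷ refine 1 3 (811 ∷ []) ∷
    refine 3 1 (163 ∷ 1297 ∷ 1621 ∷ 6481 ∷ []) ∷ []) ∷
  sieved (refine 5 5 (11 ∷ 41 ∷ []) ∷ refine 6 1 (61 ∷ []) ∷ refine 1 3 (7 ∷ 31 ∷ []) ∷ refine 1 2 (13 ∷ []) ∷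
    refine 1 2 (241 ∷ []) ∷ refine 1 3 (37 ∷ []) ∷ refine 3 1 (19 ∷ 73 ∷ 109 ∷ []) ∷ []) ∷
  sieved (refine 1 1 (3 ∷ []) ∷ []) ∷
  square 14 ∷
  sieved (refine 1 5 (11 ∷ []) ∷ []) ∷
  sieved (refine 1 1 (3 ∷ []) ∷ []) ∷
  sieved (refine 3 1 (13 ∷ []) ∷ refine 1 3 (7 ∷ []) ∷ refine 3 1 (19 ∷ []) ∷ []) ∷
  sieved (refine 1 2 (5 ∷ []) ∷ []) ∷
  sieved (refine 1 1 (3 ∷ []) ∷ []) ∷
  sieved (refine 2 1 (5 ∷ []) ∷ refine 3 1 (7 ∷ []) ∷ refine 1 3 (13 ∷ []) ∷ refine 5 1 (4561 ∷ []) ∷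
    refine 1 5 (11 ∷ 31 ∷ []) ∷ refine 1 2 (41 ∷ []) ∷ refine 1 3 (19 ∷ 37 ∷ 73 ∷ 181 ∷ []) ∷
    refine 2 2 (241 ∷ []) ∷ refine 2 1 (97 ∷ 113 ∷ []) ∷ refine 5 1 (601 ∷ []) ∷
    refine 1 5 (101 ∷ 151 ∷ 1201 ∷ []) ∷ refine 2 1 (1601 ∷ []) ∷ []) ∷
  sieved (refine 3 2 (13 ∷ []) ∷ refine 5 1 (11 ∷ []) ∷ refine 1 5 (31 ∷ 61 ∷ 421 ∷ []) ∷
    refine 1 5 (751 ∷ []) ∷ refine 5 1 (151 ∷ []) ∷ refine 2 1 (101 ∷ []) ∷ refine 2 1 (401 ∷ []) ∷
    refine 1 2 (41 ∷ 601 ∷ []) ∷ refine 1 3 (181 ∷ []) ∷ refine 3 1 (271 ∷ 541 ∷ []) ∷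
    refine 1 3 (19 ∷ 37 ∷ 73 ∷ 1801 ∷ []) ∷ refine 2 1 (1201 ∷ []) ∷ refine 1 2 (17 ∷ 241 ∷ []) ∷
    refine 1 3 (433 ∷ []) ∷ refine 3 1 (109 ∷ 2161 ∷ []) ∷ refine 1 3 (1621 ∷ 4051 ∷ 8101 ∷ []) ∷
    refine 1 2 (97 ∷ 2593 ∷ []) ∷ refine 3 1 (163 ∷ 811 ∷ 1297 ∷ []) ∷ []) ∷
  sieved (refine 1 1 (3 ∷ []) ∷ []) ∷
  sieved (refine 1 2 (5 ∷ []) ∷ []) ∷
  sieved (refine 1 14 (29 ∷ []) ∷ []) ∷
  sieved (refine 1 1 (3 ∷ []) ∷ []) ∷
  sieved (refine 1 5 (11 ∷ []) ∷ []) ∷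
  sieved (refine 3 1 (7 ∷ []) ∷ refine 5 3 (271 ∷ []) ∷ refine 1 5 (11 ∷ 31 ∷ []) ∷ refine 2 1 (61 ∷ []) ∷
    refine 1 3 (181 ∷ []) ∷ refine 3 1 (19 ∷ 37 ∷ 109 ∷ []) ∷ refine 3 1 (541 ∷ []) ∷
    refine 7 14 (29 ∷ 43 ∷ 71 ∷ 127 ∷ 211 ∷ 337 ∷ 421 ∷ 631 ∷ []) ∷ []) ∷
  sieved (refine 1 1 (3 ∷ []) ∷ []) ∷
  sieved (refine 6 2 (61 ∷ []) ∷ refine 1 3 (13 ∷ []) ∷ refine 7 7 (29 ∷ 43 ∷ []) ∷ refine 1 4 (1009 ∷ []) ∷
    refine 2 1 (17 ∷ 337 ∷ []) ∷ refine 2 1 (97 ∷ 113 ∷ []) ∷ refine 1 3 (127 ∷ 433 ∷ []) ∷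
    refine 3 1 (37 ∷ 73 ∷ 541 ∷ 2017 ∷ []) ∷ refine 3 1 (379 ∷ 2647 ∷ []) ∷
    refine 1 3 (109 ∷ 757 ∷ 2269 ∷ []) ∷ refine 1 3 (163 ∷ []) ∷ refine 5 1 (31 ∷ 71 ∷ []) ∷
    refine 1 5 (11 ∷ 41 ∷ []) ∷ []) ∷
  square 18 ∷
  sieved (refine 1 1 (3 ∷ []) ∷ []) ∷
  sieved (refine 5 1 (11 ∷ []) ∷ refine 3 1 (31 ∷ []) ∷ refine 7 7 (43 ∷ []) ∷ refine 1 5 (71 ∷ 211 ∷ []) ∷
    refine 1 3 (151 ∷ 421 ∷ []) ∷ refine 1 2 (13 ∷ []) ∷ refine 2 1 (29 ∷ 61 ∷ []) ∷
    refine 2 1 (281 ∷ []) ∷ refine 2 1 (673 ∷ []) ∷ refine 1 2 (41 ∷ 337 ∷ []) ∷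
    refine 1 3 (73 ∷ 631 ∷ []) ∷ refine 3 1 (19 ∷ 37 ∷ 127 ∷ 2521 ∷ []) ∷ []) ∷
  sieved (refine 1 2 (5 ∷ []) ∷ []) ∷
  sieved (refine 1 1 (3 ∷ []) ∷ []) ∷
  sieved (refine 2 1 (5 ∷ []) ∷ refine 3 1 (73 ∷ []) ∷ refine 7 7 (29 ∷ 211 ∷ []) ∷ refine 1 4 (113 ∷ []) ∷
    refine 1 2 (17 ∷ []) ∷ refine 4 1 (337 ∷ 673 ∷ []) ∷ refine 1 3 (43 ∷ 97 ∷ []) ∷
    refine 1 5 (241 ∷ 281 ∷ 421 ∷ []) ∷ refine 5 1 (31 ∷ 41 ∷ 61 ∷ 71 ∷ []) ∷ refine 2 1 (577 ∷ []) ∷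
    refine 1 2 (2017 ∷ 3361 ∷ []) ∷ refine 2 2 (193 ∷ []) ∷ refine 3 1 (37 ∷ 20161 ∷ []) ∷ []) ∷
  sieved (refine 9 3 (19 ∷ []) ∷ refine 2 2 (13 ∷ []) ∷ refine 2 1 (97 ∷ []) ∷ refine 1 2 (73 ∷ []) ∷
    refine 5 1 (41 ∷ []) ∷ refine 1 5 (11 ∷ 61 ∷ 101 ∷ []) ∷ refine 1 3 (37 ∷ 181 ∷ []) ∷
    refine 1 2 (241 ∷ 2161 ∷ []) ∷ refine 3 1 (109 ∷ []) ∷ refine 1 3 (271 ∷ 433 ∷ 541 ∷ []) ∷
    refine 1 3 (1621 ∷ 2593 ∷ []) ∷ []) ∷
  sieved (refine 1 1 (3 ∷ []) ∷ []) ∷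
  sieved (refine 1 2 (5 ∷ []) ∷ []) ∷
  sieved (refine 6 3 (37 ∷ []) ∷ refine 1 3 (19 ∷ []) ∷ refine 1 2 (13 ∷ []) ∷ refine 1 4 (337 ∷ []) ∷
    refine 2 1 (17 ∷ []) ∷ refine 3 1 (73 ∷ 433 ∷ []) ∷ refine 1 2 (577 ∷ []) ∷ refine 4 1 (97 ∷ []) ∷
    refine 2 2 (193 ∷ 1153 ∷ []) ∷ refine 1 3 (2593 ∷ []) ∷ refine 3 1 (109 ∷ 1297 ∷ 3457 ∷ []) ∷
    refine 5 1 (41 ∷ 271 ∷ 541 ∷ []) ∷ refine 1 5 (31 ∷ 61 ∷ 241 ∷ 2161 ∷ 8641 ∷ 21601 ∷ []) ∷
    refine 3 1 (811 ∷ []) ∷ refine 1 3 (163 ∷ []) ∷ []) ∷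
  sieved (refine 1 1 (3 ∷ []) ∷ []) ∷
  sieved (refine 8 2 (17 ∷ []) ∷ refine 1 5 (41 ∷ []) ∷ refine 1 2 (761 ∷ []) ∷ refine 1 3 (97 ∷ []) ∷
    refine 3 1 (7 ∷ 13 ∷ []) ∷ refine 5 1 (11 ∷ 31 ∷ 61 ∷ 211 ∷ []) ∷ refine 1 2 (241 ∷ []) ∷
    refine 1 3 (181 ∷ 271 ∷ []) ∷ []) ∷
  sieved (refine 6 3 (13 ∷ []) ∷ refine 1 3 (109 ∷ []) ∷ refine 3 1 (19 ∷ 73 ∷ []) ∷ refine 1 2 (37 ∷ []) ∷
    refine 5 1 (1171 ∷ []) ∷ refine 1 5 (11 ∷ 31 ∷ 61 ∷ 181 ∷ []) ∷ refine 5 1 (151 ∷ []) ∷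
    refine 1 5 (101 ∷ 4201 ∷ []) ∷ refine 1 2 (601 ∷ 1601 ∷ []) ∷ refine 2 1 (41 ∷ 1801 ∷ []) ∷
    refine 1 2 (241 ∷ []) ∷ refine 1 2 (21601 ∷ []) ∷ refine 2 1 (17 ∷ 1201 ∷ []) ∷
    refine 2 1 (97 ∷ 577 ∷ []) ∷ []) ∷
  sieved (refine 1 1 (3 ∷ []) ∷ []) ∷
  sieved (refine 1 6 (13 ∷ []) ∷ []) ∷
  sieved (refine 2 1 (5 ∷ []) ∷ refine 3 3 (7 ∷ []) ∷ refine 1 2 (13 ∷ []) ∷ refine 3 1 (19 ∷ []) ∷
    refine 5 5 (11 ∷ 31 ∷ 61 ∷ 181 ∷ []) ∷ refine 1 7 (29 ∷ 631 ∷ []) ∷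
    refine 7 1 (43 ∷ 71 ∷ 127 ∷ 211 ∷ 421 ∷ []) ∷ refine 2 1 (449 ∷ 20161 ∷ []) ∷
    refine 1 2 (41 ∷ 2521 ∷ []) ∷ []) ∷
  sieved (refine 1 1 (3 ∷ []) ∷ []) ∷
  sieved (refine 5 5 (11 ∷ []) ∷ refine 3 1 (751 ∷ []) ∷ refine 1 2 (13 ∷ 61 ∷ []) ∷ refine 1 3 (7 ∷ 31 ∷ []) ∷
    refine 4 1 (41 ∷ []) ∷ refine 1 2 (73 ∷ 2521 ∷ []) ∷ refine 1 3 (19 ∷ 37 ∷ []) ∷
    refine 3 1 (181 ∷ []) ∷ refine 1 3 (271 ∷ 1621 ∷ []) ∷ refine 1 2 (241 ∷ []) ∷
    refine 2 1 (2161 ∷ []) ∷ refine 2 1 (97 ∷ []) ∷ refine 2 1 (8641 ∷ []) ∷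
    refine 3 1 (109 ∷ 433 ∷ 541 ∷ []) ∷ refine 1 3 (163 ∷ 1297 ∷ []) ∷ []) ∷
  sieved (refine 1 2 (5 ∷ []) ∷ []) ∷
  sieved (refine 1 1 (3 ∷ []) ∷ []) ∷
  square 22 ∷
  sieved (refine 3 3 (7 ∷ []) ∷ refine 3 1 (37 ∷ []) ∷ refine 1 3 (19 ∷ []) ∷ refine 2 2 (13 ∷ []) ∷
    refine 1 3 (109 ∷ []) ∷ refine 2 1 (73 ∷ 433 ∷ []) ∷ refine 2 1 (17 ∷ []) ∷ refine 1 5 (241 ∷ []) ∷
    refine 5 1 (11 ∷ 31 ∷ 61 ∷ 181 ∷ []) ∷ []) ∷
  sieved (refine 1 1 (3 ∷ []) ∷ []) ∷
  sieved (refine 1 2 (5 ∷ []) ∷ []) ∷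
  sieved (refine 5 1 (11 ∷ []) ∷ refine 3 3 (7 ∷ []) ∷ refine 1 5 (31 ∷ []) ∷ refine 3 1 (181 ∷ []) ∷
    refine 1 3 (19 ∷ []) ∷ refine 1 3 (163 ∷ []) ∷ refine 3 1 (271 ∷ 23761 ∷ []) ∷
    refine 2 1 (109 ∷ 541 ∷ []) ∷ refine 1 2 (37 ∷ 61 ∷ []) ∷ refine 2 1 (2161 ∷ []) ∷
    refine 1 2 (41 ∷ 73 ∷ []) ∷ refine 1 2 (97 ∷ 241 ∷ []) ∷ refine 2 1 (17 ∷ 433 ∷ []) ∷
    refine 5 1 (601 ∷ []) ∷ refine 1 5 (101 ∷ 151 ∷ 401 ∷ 701 ∷ 1201 ∷ []) ∷ refine 2 1 (21601 ∷ []) ∷ []) ∷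
  sieved (refine 1 1 (3 ∷ []) ∷ []) ∷
  sieved (refine 3 1 (13 ∷ []) ∷ refine 4 1 (41 ∷ []) ∷ refine 1 4 (97 ∷ []) ∷ refine 1 2 (17 ∷ []) ∷
    refine 1 3 (37 ∷ []) ∷ refine 3 1 (73 ∷ []) ∷ refine 3 3 (433 ∷ []) ∷ []) ∷
  sieved (refine 1 6 (13 ∷ []) ∷ []) ∷
  sieved (refine 1 1 (3 ∷ []) ∷ []) ∷
  sieved (refine 1 5 (11 ∷ []) ∷ []) ∷
  sieved (refine 2 1 (5 ∷ []) ∷ refine 3 2 (13 ∷ []) ∷ refine 3 9 (19 ∷ 37 ∷ []) ∷ refine 5 1 (31 ∷ []) ∷
    refine 1 5 (11 ∷ 61 ∷ 181 ∷ []) ∷ refine 3 1 (109 ∷ []) ∷ refine 1 3 (271 ∷ 541 ∷ 4861 ∷ []) ∷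
    refine 2 1 (2089 ∷ []) ∷ refine 2 1 (241 ∷ []) ∷ refine 1 2 (73 ∷ []) ∷
    refine 1 2 (17 ∷ 433 ∷ 2161 ∷ []) ∷ refine 2 1 (97 ∷ []) ∷ refine 1 4 (193 ∷ 577 ∷ 8641 ∷ []) ∷
    refine 1 7 (449 ∷ 3361 ∷ 15121 ∷ []) ∷ []) ∷
  sieved (refine 1 1 (3 ∷ []) ∷ []) ∷
  sieved (refine 1 9 (19 ∷ []) ∷ []) ∷
  sieved (refine 1 2 (5 ∷ []) ∷ []) ∷
  sieved (refine 1 1 (3 ∷ []) ∷ []) ∷
  sieved (refine 2 1 (5 ∷ []) ∷ refine 3 3 (7 ∷ []) ∷ refine 1 3 (37 ∷ []) ∷ refine 3 1 (19 ∷ []) ∷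
    refine 5 1 (11 ∷ []) ∷ refine 1 2 (181 ∷ []) ∷ refine 2 1 (97 ∷ []) ∷ refine 1 2 (73 ∷ []) ∷
    refine 1 5 (31 ∷ 41 ∷ 61 ∷ 241 ∷ []) ∷ refine 1 3 (109 ∷ 271 ∷ 541 ∷ []) ∷
    refine 1 5 (601 ∷ 1201 ∷ []) ∷ refine 5 1 (101 ∷ 401 ∷ 6301 ∷ []) ∷ []) ∷
  sieved (refine 5 5 (11 ∷ []) ∷ refine 3 1 (31 ∷ []) ∷ refine 1 3 (7 ∷ []) ∷ refine 1 2 (61 ∷ []) ∷
    refine 1 3 (19 ∷ []) ∷ refine 3 1 (181 ∷ 541 ∷ []) ∷ refine 2 1 (37 ∷ []) ∷ refine 1 2 (73 ∷ []) ∷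
    refine 2 1 (41 ∷ []) ∷ refine 6 1 (433 ∷ 2161 ∷ []) ∷ refine 3 1 (163 ∷ 487 ∷ 2593 ∷ []) ∷
    refine 1 3 (109 ∷ 271 ∷ 811 ∷ []) ∷ refine 1 2 (241 ∷ []) ∷ refine 1 3 (1297 ∷ 1621 ∷ []) ∷ []) ∷
  sieved (refine 1 1 (3 ∷ []) ∷ []) ∷
  sieved (refine 1 2 (5 ∷ []) ∷ []) ∷
  sieved (refine 3 1 (7 ∷ 13 ∷ []) ∷ []) ∷
  sieved (refine 1 1 (3 ∷ []) ∷ []) ∷
  sieved (refine 3 6 (13 ∷ []) ∷ refine 2 1 (37 ∷ []) ∷ refine 1 3 (19 ∷ []) ∷ refine 5 1 (181 ∷ []) ∷
    refine 1 5 (11 ∷ 41 ∷ 61 ∷ 3331 ∷ []) ∷ refine 7 1 (43 ∷ 211 ∷ []) ∷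
    refine 1 7 (29 ∷ 71 ∷ 127 ∷ 421 ∷ []) ∷ refine 1 2 (113 ∷ []) ∷ refine 2 1 (281 ∷ 2521 ∷ 2689 ∷ []) ∷ []) ∷
  sieved (refine 11 1 (661 ∷ []) ∷ refine 1 11 (23 ∷ 199 ∷ []) ∷ refine 3 3 (7 ∷ []) ∷
    refine 1 3 (19 ∷ 2179 ∷ []) ∷ refine 2 1 (13 ∷ []) ∷ refine 2 1 (23761 ∷ []) ∷ refine 1 2 (397 ∷ []) ∷
    refine 4 1 (193 ∷ 3169 ∷ []) ∷ refine 3 1 (37 ∷ 73 ∷ []) ∷ refine 1 5 (991 ∷ []) ∷
    refine 5 1 (31 ∷ 41 ∷ 181 ∷ []) ∷ []) ∷
  sieved (refine 1 1 (3 ∷ []) ∷ []) ∷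
  square 26 ∷
  sieved (refine 2 1 (5 ∷ []) ∷ refine 5 5 (11 ∷ []) ∷ refine 3 1 (31 ∷ []) ∷ refine 1 3 (7 ∷ 61 ∷ []) ∷
    refine 1 2 (13 ∷ []) ∷ refine 2 2 (41 ∷ []) ∷ refine 1 2 (241 ∷ []) ∷ refine 1 2 (97 ∷ []) ∷
    refine 1 2 (193 ∷ 769 ∷ []) ∷ refine 1 3 (577 ∷ 1801 ∷ []) ∷ refine 3 1 (37 ∷ 73 ∷ 181 ∷ []) ∷
    refine 3 1 (433 ∷ []) ∷ refine 1 3 (109 ∷ 271 ∷ 541 ∷ []) ∷ []) ∷
  sieved (refine 1 1 (3 ∷ []) ∷ []) ∷
  sieved (refine 3 9 (19 ∷ []) ∷ refine 3 1 (37 ∷ []) ∷ refine 2 2 (13 ∷ []) ∷ refine 1 2 (73 ∷ []) ∷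
    refine 5 1 (41 ∷ 61 ∷ []) ∷ refine 1 5 (11 ∷ 31 ∷ 181 ∷ []) ∷ refine 4 1 (1873 ∷ 4561 ∷ []) ∷
    refine 1 2 (17 ∷ 241 ∷ []) ∷ refine 1 2 (193 ∷ []) ∷ refine 3 1 (109 ∷ 1621 ∷ []) ∷
    refine 1 3 (271 ∷ 433 ∷ 541 ∷ 2161 ∷ []) ∷ refine 2 1 (97 ∷ 14401 ∷ []) ∷ []) ∷
  sieved (refine 1 2 (5 ∷ []) ∷ []) ∷
  sieved (refine 1 1 (3 ∷ []) ∷ []) ∷
  sieved (refine 2 1 (5 ∷ []) ∷ refine 3 3 (7 ∷ 13 ∷ []) ∷ refine 3 3 (19 ∷ 37 ∷ []) ∷ refine 2 2 (73 ∷ []) ∷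
    refine 1 4 (17 ∷ []) ∷ refine 1 3 (433 ∷ 1297 ∷ []) ∷ refine 3 1 (109 ∷ 2917 ∷ []) ∷
    refine 4 1 (193 ∷ 19009 ∷ []) ∷ refine 1 2 (97 ∷ 577 ∷ []) ∷
    refine 1 7 (379 ∷ 449 ∷ 757 ∷ 2017 ∷ []) ∷ refine 1 3 (2269 ∷ []) ∷ refine 3 1 (163 ∷ 2593 ∷ []) ∷ []) ∷
  sieved (refine 1 5 (11 ∷ []) ∷ []) ∷
  sieved (refine 1 1 (3 ∷ []) ∷ []) ∷
  sieved (refine 1 2 (5 ∷ []) ∷ []) ∷
  sieved (refine 9 1 (757 ∷ []) ∷ refine 1 6 (13 ∷ []) ∷ refine 1 3 (19 ∷ []) ∷ refine 2 1 (37 ∷ []) ∷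
    refine 2 2 (17 ∷ 73 ∷ []) ∷ refine 2 2 (113 ∷ []) ∷ refine 1 7 (43 ∷ 337 ∷ 2689 ∷ []) ∷
    refine 7 1 (29 ∷ 127 ∷ 211 ∷ 673 ∷ 2017 ∷ []) ∷ []) ∷
  sieved (refine 1 1 (3 ∷ []) ∷ []) ∷
  sieved (refine 3 2 (13 ∷ []) ∷ refine 1 3 (7 ∷ []) ∷ refine 10 1 (61 ∷ 181 ∷ []) ∷ refine 1 5 (11 ∷ 31 ∷ []) ∷
    refine 2 1 (4441 ∷ []) ∷ refine 1 2 (41 ∷ 97 ∷ 241 ∷ []) ∷ refine 1 2 (17 ∷ []) ∷
    refine 1 3 (37 ∷ 73 ∷ []) ∷ refine 1 5 (151 ∷ 1801 ∷ []) ∷ []) ∷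
  sieved (refine 5 1 (11 ∷ []) ∷ refine 1 3 (61 ∷ []) ∷ refine 3 1 (7 ∷ 31 ∷ []) ∷ refine 2 6 (109 ∷ []) ∷
    refine 3 1 (37 ∷ 541 ∷ []) ∷ refine 2 1 (73 ∷ []) ∷ refine 1 5 (181 ∷ 401 ∷ []) ∷
    refine 2 2 (17 ∷ []) ∷ refine 2 1 (97 ∷ []) ∷ refine 1 2 (241 ∷ []) ∷ refine 2 1 (577 ∷ []) ∷
    refine 1 2 (193 ∷ 8641 ∷ []) ∷ refine 3 1 (433 ∷ []) ∷ refine 1 3 (271 ∷ 2161 ∷ []) ∷
    refine 1 3 (1297 ∷ 1621 ∷ []) ∷ refine 3 1 (163 ∷ 811 ∷ 2593 ∷ []) ∷ refine 5 1 (4801 ∷ 21601 ∷ []) ∷ []) ∷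
  sieved (refine 1 1 (3 ∷ []) ∷ []) ∷
  sieved (refine 1 7 (43 ∷ []) ∷ []) ∷
  sieved (refine 2 1 (5 ∷ []) ∷ refine 3 2 (7 ∷ 61 ∷ []) ∷ []) ∷
  sieved (refine 1 1 (3 ∷ []) ∷ []) ∷
  sieved (refine 1 5 (11 ∷ []) ∷ []) ∷
  sieved (refine 1 2 (5 ∷ []) ∷ []) ∷
  sieved (refine 1 1 (3 ∷ []) ∷ []) ∷
  sieved (refine 2 1 (5 ∷ []) ∷ refine 3 1 (13 ∷ []) ∷ refine 1 9 (73 ∷ []) ∷ refine 3 1 (19 ∷ 37 ∷ []) ∷
    refine 5 5 (11 ∷ 31 ∷ []) ∷ refine 1 3 (541 ∷ []) ∷ refine 3 1 (109 ∷ 271 ∷ []) ∷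
    refine 2 1 (601 ∷ []) ∷ refine 2 1 (433 ∷ 2161 ∷ []) ∷ refine 1 3 (811 ∷ 6481 ∷ []) ∷
    refine 3 1 (163 ∷ 1621 ∷ []) ∷ refine 1 4 (41 ∷ []) ∷ refine 1 2 (17 ∷ 1297 ∷ []) ∷
    refine 1 2 (193 ∷ []) ∷ []) ∷
  sieved (refine 1 6 (13 ∷ []) ∷ []) ∷
  sieved (refine 1 1 (3 ∷ []) ∷ []) ∷
  sieved (refine 1 2 (5 ∷ []) ∷ []) ∷
  sieved (refine 5 5 (11 ∷ 31 ∷ []) ∷ refine 1 3 (181 ∷ []) ∷ refine 1 2 (421 ∷ []) ∷ refine 3 1 (13 ∷ []) ∷
    refine 3 3 (19 ∷ 37 ∷ []) ∷ refine 1 3 (271 ∷ []) ∷ refine 3 1 (109 ∷ []) ∷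
    refine 3 1 (163 ∷ 811 ∷ []) ∷ refine 2 1 (61 ∷ 541 ∷ []) ∷ refine 1 3 (1621 ∷ 9721 ∷ []) ∷
    refine 4 1 (6481 ∷ []) ∷ refine 1 2 (41 ∷ []) ∷ refine 1 2 (241 ∷ 433 ∷ 1297 ∷ 2161 ∷ 2593 ∷ []) ∷
    refine 2 1 (97 ∷ []) ∷ refine 1 2 (449 ∷ []) ∷ refine 1 2 (193 ∷ []) ∷ refine 2 1 (577 ∷ 8641 ∷ []) ∷
    refine 1 5 (401 ∷ 4801 ∷ 9001 ∷ 14401 ∷ []) ∷ []) ∷
  sieved (refine 1 1 (3 ∷ []) ∷ []) ∷
  sieved (refine 6 2 (13 ∷ []) ∷ refine 1 5 (61 ∷ []) ∷ refine 1 3 (7 ∷ []) ∷ refine 5 1 (31 ∷ 41 ∷ []) ∷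
    refine 1 2 (241 ∷ []) ∷ refine 1 3 (181 ∷ []) ∷ refine 3 1 (19 ∷ 37 ∷ []) ∷ refine 3 1 (271 ∷ []) ∷
    refine 1 3 (109 ∷ 433 ∷ 541 ∷ []) ∷ refine 3 1 (163 ∷ 1621 ∷ 4861 ∷ []) ∷
    refine 1 3 (811 ∷ 9721 ∷ []) ∷ refine 2 1 (17 ∷ 73 ∷ []) ∷ refine 2 1 (3889 ∷ 6481 ∷ []) ∷
    refine 1 2 (1297 ∷ 2161 ∷ []) ∷ refine 1 4 (193 ∷ 1153 ∷ []) ∷ refine 2 1 (97 ∷ []) ∷
    refine 2 1 (577 ∷ []) ∷ refine 1 7 (673 ∷ 2521 ∷ []) ∷ []) ∷
  square 30 ∷
  sieved (refine 1 1 (3 ∷ []) ∷ []) ∷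
  sieved (refine 4 4 (41 ∷ []) ∷ refine 2 1 (17 ∷ []) ∷ refine 3 1 (7 ∷ []) ∷ refine 1 3 (13 ∷ 97 ∷ []) ∷
    refine 1 7 (337 ∷ 449 ∷ []) ∷ refine 7 1 (29 ∷ 43 ∷ []) ∷ refine 1 2 (113 ∷ []) ∷
    refine 3 1 (127 ∷ 2017 ∷ []) ∷ refine 1 3 (19 ∷ 37 ∷ 73 ∷ []) ∷ refine 2 1 (673 ∷ []) ∷
    refine 1 3 (379 ∷ []) ∷ refine 5 1 (281 ∷ 7561 ∷ []) ∷ refine 1 5 (11 ∷ 31 ∷ 71 ∷ 211 ∷ []) ∷ []) ∷
  sieved (refine 2 1 (5 ∷ []) ∷ refine 9 1 (37 ∷ []) ∷ refine 1 3 (19 ∷ []) ∷ refine 5 1 (31 ∷ []) ∷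
    refine 1 2 (181 ∷ []) ∷ refine 1 5 (61 ∷ 241 ∷ []) ∷ refine 1 11 (67 ∷ 661 ∷ 3301 ∷ []) ∷
    refine 11 1 (23 ∷ 89 ∷ 331 ∷ 397 ∷ []) ∷ refine 1 2 (41 ∷ 1321 ∷ []) ∷
    refine 1 3 (199 ∷ 991 ∷ 4951 ∷ []) ∷ refine 2 1 (73 ∷ []) ∷ refine 2 1 (353 ∷ 881 ∷ []) ∷
    refine 1 2 (17 ∷ []) ∷ refine 1 2 (97 ∷ 5281 ∷ []) ∷ refine 1 3 (433 ∷ 23761 ∷ []) ∷ []) ∷
  sieved (refine 1 1 (3 ∷ []) ∷ []) ∷
  sieved (refine 3 3 (7 ∷ []) ∷ refine 2 1 (13 ∷ []) ∷ refine 3 1 (73 ∷ []) ∷ refine 1 3 (19 ∷ []) ∷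
    refine 1 2 (37 ∷ []) ∷ refine 3 1 (109 ∷ 163 ∷ []) ∷ refine 7 1 (29 ∷ 43 ∷ []) ∷
    refine 1 7 (127 ∷ 757 ∷ 2269 ∷ []) ∷ refine 1 4 (1009 ∷ 2017 ∷ []) ∷ refine 2 1 (17 ∷ 433 ∷ []) ∷
    refine 1 3 (379 ∷ 1297 ∷ []) ∷ refine 2 1 (113 ∷ []) ∷ []) ∷
  sieved (refine 1 2 (5 ∷ []) ∷ []) ∷
  sieved (refine 1 1 (3 ∷ []) ∷ []) ∷
  sieved (refine 2 1 (5 ∷ []) ∷ refine 3 3 (7 ∷ []) ∷ refine 1 2 (13 ∷ []) ∷ refine 1 3 (19 ∷ []) ∷
    refine 3 1 (37 ∷ 127 ∷ []) ∷ refine 2 2 (73 ∷ []) ∷ refine 2 1 (193 ∷ 257 ∷ []) ∷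
    refine 1 3 (433 ∷ 2161 ∷ []) ∷ refine 3 1 (109 ∷ []) ∷ refine 1 2 (17 ∷ []) ∷
    refine 3 1 (1297 ∷ 2593 ∷ []) ∷ refine 1 3 (163 ∷ []) ∷ refine 7 1 (757 ∷ []) ∷
    refine 1 7 (29 ∷ 43 ∷ 113 ∷ 337 ∷ []) ∷ []) ∷
  sieved (refine 1 14 (29 ∷ []) ∷ []) ∷
  sieved (refine 1 1 (3 ∷ []) ∷ []) ∷
  sieved (refine 1 2 (5 ∷ []) ∷ []) ∷
  sieved (refine 1 5 (11 ∷ []) ∷ []) ∷
  []

certificates-valid : allValid 4 certificates ≡ true
certificates-valid = refl

-- Assembling the theorem

odd-multiple-of-4 : ∀ k → 4 ∣ k → ¬ (8 ∣ k) → ∃ λ h → k ≡ h * 8 + 4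
odd-multiple-of-4 k (divides c refl) 8∤k with parity c
... | h , inj₁ refl = contradiction (divides h (*-assoc h 2 4)) 8∤k
... | h , inj₂ refl = h , expand h
  where
  expand : ∀ h → suc (h * 2) * 4 ≡ h * 8 + 4
  expand = solve-∀

certificate : ∀ k → k ≤ 1000 → 4 ∣ k → ¬ (8 ∣ k) → ∃ λ c → T (valid k c)
certificate k k≤1000 4∣k 8∤k with h , refl ← odd-multiple-of-4 k 4∣k 8∤k | h <? 125
-- The 125 certificates reach up to 8 * 124 + 4 = 996; from h = 125 on, k is at least 1004.
... | yes h<125 = allValid-sound 4 certificates certificates-valid h h<125
... | no  h≮125 = contradiction k≤1000 (<⇒≱ (≤-trans (m≤m+n 1001 3) (+-monoˡ-≤ 4 (*-monoˡ-≤ 8 (≮⇒≥ h≮125)))))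

-- A `sieved` certificate refutes the solution, so only a `square` one can remain. With k = t ^ 2
-- the power k ^ z is the square of t ^ z, and odd z joins the case of even z.
z-odd⇒square : ∀ k c x s h → T (valid k c) → Solution k (2 * k ∸ 1) x (suc (s * 2)) (suc (h * 2)) → ∃ λ t → t * t ≡ k
z-odd⇒square k (square t)  x s h ok _   = t , ≡ᵇ⇒≡ (t * t) k ok
z-odd⇒square k (sieved rs) x s h ok sol with adm , excluded ← Equivalence.to T-∧ ok =
  contradiction sol (sieve-sound k (2 * k ∸ 1) rs 2 2 0 0 adm excluded s h x)

theorem1p3 : (k : ℕ) → 4 ≤ k → k ≤ 1000 → 4 ∣ k → ¬ (8 ∣ k) → IsPrimePower (2 * k ∸ 1) → (x y z : ℕ) → 1 ≤ x → 1 ≤ y → 1 ≤ z → x ^ 2 + (2 * k ∸ 1) ^ y ≡ k ^ z → x ≡ k ∸ 1 × y ≡ 1 × z ≡ 2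
theorem1p3 K@(suc k) 4≤K K≤1000 4∣K 8∤K pp x y z 1≤x 1≤y 1≤z eq = x≡k , trans y≡ (cong (λ s → suc (s * 2)) s≡0) , z≡2
  where
  q≡ : 2 * K ∸ 1 ≡ suc (k * 2)
  q≡ = cong (_∸ 1) (*-comm 2 K)
  sol : Solution K (suc (k * 2)) x y z
  sol = subst (λ q → Solution K q x y z) q≡ eq
  s = proj₁ (exponent-odd k x y z 4∣K 1≤z sol)
  y≡ : y ≡ suc (s * 2)
  y≡ = proj₂ (exponent-odd k x y z 4∣K 1≤z sol)
  K^z-square : ∃ λ c → c * c ≡ K ^ z
  K^z-square with parity z
  ... | h , inj₁ refl = K ^ h , ^-square K h
  ... | h , inj₂ refl with cert , ok ← certificate K K≤1000 4∣K 8∤K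
                      with t , t²≡K ← z-odd⇒square K cert x s h ok (subst (λ y → Solution K (2 * K ∸ 1) x y z) y≡ eq)
    = t ^ z , trans (^-square t z) (trans (cong (t ^_) (*-comm z 2)) (trans (sym (^-*-assoc t 2 z))
        (cong (_^ z) (trans (cong (t *_) (*-identityʳ t)) t²≡K))))
  solution = solution-with-square k (subst IsPrimePower q≡ pp) 4≤K (∣-trans (divides 2 refl) 4∣K) x s z
    (proj₁ K^z-square) 1≤x (proj₂ K^z-square) (subst (λ y → Solution K (suc (k * 2)) x y z) y≡ sol)
  x≡k = proj₁ solution
  s≡0 = proj₁ (proj₂ solution)
  z≡2 = proj₂ (proj₂ solution)
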